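{- There exist an odd positive integer $M$ and an integer $\alpha$ such that the residue class $\{x\in\mathbb{Z}:\ x\equiv\alpha\pmod{M}\}$ contains no integer of the form $p^2+b^2-2^n$ with $p$ prime and $b,n\in\mathbb{N}$.
   Context: $\mathbb{N}=\{0,1,2,\ldots\}$. -}

module Defs where

open import Data.Integer using (ℤ; +_; _+_; _-_; _^_)
open import Data.Integer.Divisibility.Signed using (_∣_)
open import Data.Nat as ℕ using (ℕ)
open import Data.Nat.Primality using (Prime)
open import Data.Product using (∃-syntax; _×_)
open import Relation.Binary.PropositionalEquality using (_≡_)

Odd : ℕ → Set
Odd m = ∃[ k ] m ≡ 2 ℕ.* k ℕ.+ 1

infix 4 _≡_[mod_]

_≡_[mod_] : ℤ → ℤ → ℕ → Set
x ≡ y [mod m ] = + m ∣ x - y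

-- Subtraction is in ℤ, so the represented integer may be negative.
Representable : ℤ → Set
Representable x =
  ∃[ p ] ∃[ b ] ∃[ n ] Prime p × x ≡ (+ p) ^ 2 + (+ b) ^ 2 - (+ 2) ^ n

{-# OPTIONS --safe #-}
module Submission where

-- If a prime q ≡ 3 (mod 4) divides p² + b² with p prime, then p = q, because -1 is not a square
-- modulo q. The residue classes a (mod o) in the list below cover ℕ, and α is chosen so that
-- q ∣ α + 2ⁿ for n ≡ a (mod o); hence x + 2ⁿ = p² + b² with x ≡ α forces p = q. What remains is
-- q² + b² = x + 2ⁿ with n ≡ a (mod o), which fails modulo a small r, where α + 2ⁿ - q² is never
-- a square for these n. The modulus M is the product of all q and of the additional r = 5, 13, 29.

open import Defs
open import Data.Integer as ℤ using (ℤ; +_)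
import Data.Integer.Divisibility.Signed as ℤᵈ
import Data.Integer.Properties as ℤₚ
import Data.Integer.Tactic.RingSolver as ℤ-Solver
open import Data.List.Base using (List; []; _∷_; map)
open import Data.List.Relation.Unary.All as All using (All)
open import Data.List.Relation.Unary.Any as Any using (Any)
open import Data.List.Membership.Propositional using (find)
open import Data.Nat using (ℕ; zero; suc; _+_; _*_; _∸_; _≤_; _<_; z≤n; s≤s; NonZero;
  NonTrivial; nonTrivial⇒n>1; n>1⇒nonTrivial; _≤?_; _<?_; _≟_)
open import Data.Nat.Coprimality using (Coprime; coprime-Bézout)
open import Data.Nat.DivMod using (_/_; _%_; m≡m%n+[m/n]*n; m%n<n; %-distribˡ-*; [m+kn]%n≡m%n)
open import Data.Nat.Divisibility using (_∣_; _∣?_; _∣0; divides; hasNonTrivialDivisor;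
  ∣m+n∣m⇒∣n; ∣m∣n⇒∣m+n; m∣m*n; n∣m*n; ∣n⇒∣m*n; ∣1⇒≡1)
open import Data.Nat.GCD using (module Bézout)
open import Data.Nat.Induction using (<-rec)
open import Data.Nat.ListAction using (product)
open import Data.Nat.Primality using (Prime; prime⇒irreducible; ¬prime[1]; rough∧square>⇒prime;
  _Rough_)
open import Data.Nat.Properties using (*-cancelʳ-<; *-mono-≤; *-comm; *-assoc; m<m+n; m≤m+n;
  ≤-trans; m∸n+n≡m; m+[n∸m]≡n; +-∸-comm; <⇒≤; allUpTo?; nonZero?; module ≤-Reasoning)
open import Data.Nat.Tactic.RingSolver using (solve-∀)
open import Data.Product using (Σ-syntax; ∃-syntax; _×_; _,_)
open import Data.Sum using (_⊎_; inj₁; inj₂)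
open import Relation.Binary.PropositionalEquality using (_≡_; refl; sym; trans; cong; cong₂;
  subst; module ≡-Reasoning)
open import Relation.Nullary using (¬_; Dec; yes; no; contradiction; ¬?)
open import Relation.Nullary.Decidable using (map′; toWitness; _×-dec_; _→-dec_)

-- Square roots of -1 and sums of two squares modulo Q ≡ 3 (mod 4)

even-or-odd : ∀ n → ∃[ c ] (n ≡ 2 * c ⊎ n ≡ 1 + 2 * c)
even-or-odd zero = 0 , inj₁ refl
even-or-odd (suc n) with even-or-odd n
... | c , inj₁ n≡2c   = c , inj₂ (cong suc n≡2c)
... | c , inj₂ n≡1+2c = suc c , inj₁ (trans (cong suc n≡1+2c) (double-suc c))
  where
  double-suc : ∀ c → 2 + 2 * c ≡ 2 * suc c
  double-suc = solve-∀

3-mod-4⇒odd : ∀ {Q} → Q % 4 ≡ 3 → ∀ c → ¬ Q ≡ 2 * c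
3-mod-4⇒odd {Q} Q%4≡3 c Q≡2c = contradiction (trans (sym odd) even) λ ()
  where
  odd : Q % 2 ≡ 1
  odd = begin
    Q % 2                         ≡⟨ cong (_% 2) (m≡m%n+[m/n]*n Q 4) ⟩
    (Q % 4 + Q / 4 * 4) % 2       ≡⟨ cong (λ r → (r + Q / 4 * 4) % 2) Q%4≡3 ⟩
    (3 + Q / 4 * 4) % 2           ≡⟨ cong (_% 2) (regroup (Q / 4)) ⟩
    (1 + (1 + 2 * (Q / 4)) * 2) % 2
                                  ≡⟨ [m+kn]%n≡m%n 1 (1 + 2 * (Q / 4)) 2 ⟩
    1                             ∎
    where
    open ≡-Reasoning
    regroup : ∀ s → 3 + s * 4 ≡ 1 + (1 + 2 * s) * 2
    regroup = solve-∀
  even : Q % 2 ≡ 0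
  even = trans (cong (_% 2) (trans Q≡2c (*-comm 2 c))) ([m+kn]%n≡m%n 0 c 2)

-- 3 is its own inverse modulo 4.
cofactor-3-mod-4 : ∀ {R Q} → Q % 4 ≡ 3 → (R * Q) % 4 ≡ 1 → R % 4 ≡ 3
cofactor-3-mod-4 {R} {Q} Q%4≡3 RQ%4≡1 = residue (R % 4) (m%n<n R 4) (begin
  (R % 4 * 3) % 4       ≡⟨ cong (λ r → (R % 4 * r) % 4) Q%4≡3 ⟨
  (R % 4 * (Q % 4)) % 4 ≡⟨ %-distribˡ-* R Q 4 ⟨
  (R * Q) % 4           ≡⟨ RQ%4≡1 ⟩
  1                     ∎)
  where
  open ≡-Reasoning
  residue : ∀ r → r < 4 → (r * 3) % 4 ≡ 1 → r ≡ 3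
  residue 0 _ ()
  residue 1 _ ()
  residue 2 _ ()
  residue 3 _ _ = refl
  residue (suc (suc (suc (suc _)))) (s≤s (s≤s (s≤s (s≤s ())))) _

-- Both `m` = a mod Q and `e` = Q - `m` are roots, and exactly one of them is even because their sum
-- Q is odd. An even root 2c gives 1 + 4c² ≡ 1 (mod 4), which the descent needs to control the
-- cofactor.
even-root : ∀ {Q} → Q % 4 ≡ 3 → ∀ a → Q ∣ 1 + a * a →
            ∃[ c ] 2 * c < Q × Q ∣ 1 + 2 * c * (2 * c)
even-root {zero}      ()    _ _
even-root {Q@(suc _)} Q%4≡3 a Q∣1+a² = halve (even-or-odd m) (even-or-odd e)
  where
  m = a % Q
  e = Q ∸ m

  e+m≡Q : e + m ≡ Q
  e+m≡Q = m∸n+n≡m (<⇒≤ (m%n<n a Q))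

  Q∣1+m² : Q ∣ 1 + m * m
  Q∣1+m² = ∣m+n∣m⇒∣n (subst (Q ∣_) reduce Q∣1+a²) (n∣m*n (2 * m * (a / Q) + a / Q * (a / Q) * Q))
    where
    square : ∀ m k q → 1 + (m + k * q) * (m + k * q) ≡ (2 * m * k + k * k * q) * q + (1 + m * m)
    square = solve-∀
    reduce : 1 + a * a ≡ (2 * m * (a / Q) + a / Q * (a / Q) * Q) * Q + (1 + m * m)
    reduce = trans (cong (λ x → 1 + x * x) (m≡m%n+[m/n]*n a Q)) (square m (a / Q) Q)

  Q∣1+e² : Q ∣ 1 + e * e
  Q∣1+e² = ∣m+n∣m⇒∣n
    (subst (Q ∣_) (swap e m)
      (∣m∣n⇒∣m+n (subst (λ q → Q ∣ q * e) (sym e+m≡Q) (m∣m*n e)) Q∣1+m²))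
    (subst (λ q → Q ∣ q * m) (sym e+m≡Q) (m∣m*n m))
    where
    -- This is e² - m² = (e + m)(e - m), rearranged to avoid subtraction.
    swap : ∀ e m → (e + m) * e + (1 + m * m) ≡ (e + m) * m + (1 + e * e)
    swap = solve-∀

  halve : ∃[ c ] (m ≡ 2 * c ⊎ m ≡ 1 + 2 * c) → ∃[ d ] (e ≡ 2 * d ⊎ e ≡ 1 + 2 * d) →
          ∃[ c ] 2 * c < Q × Q ∣ 1 + 2 * c * (2 * c)
  halve (c , inj₁ m≡2c) _ =
    c , subst (_< Q) m≡2c (m%n<n a Q) , subst (λ x → Q ∣ 1 + x * x) m≡2c Q∣1+m²
  halve (c , inj₂ m≡1+2c) (d , inj₁ e≡2d) =
    d , subst (_< Q) e≡2d e<Q , subst (λ x → Q ∣ 1 + x * x) e≡2d Q∣1+e²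
    where
    -- `m` is odd, hence positive, which makes the inequality strict.
    e<Q : e < Q
    e<Q = subst (e <_) (trans (cong (λ x → e + x) (sym m≡1+2c)) e+m≡Q) (m<m+n e (s≤s z≤n))
  halve (c , inj₂ m≡1+2c) (d , inj₂ e≡1+2d) = contradiction Q≡2[1+d+c] (3-mod-4⇒odd Q%4≡3 (1 + d + c))
    where
    regroup : ∀ d c → 1 + 2 * d + (1 + 2 * c) ≡ 2 * (1 + d + c)
    regroup = solve-∀
    Q≡2[1+d+c] : Q ≡ 2 * (1 + d + c)
    Q≡2[1+d+c] = trans (sym e+m≡Q) (trans (cong₂ _+_ e≡1+2d m≡1+2c) (regroup d c))

-- Descent: for even a < Q, the cofactor of Q in 1 + a² is again ≡ 3 (mod 4), and smaller than Q.
-1-nonresidue : ∀ Q → Q % 4 ≡ 3 → ∀ a → ¬ Q ∣ 1 + a * a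
-1-nonresidue = <-rec _ step
  where
  step : ∀ Q → (∀ {R} → R < Q → R % 4 ≡ 3 → ∀ a → ¬ R ∣ 1 + a * a) →
         Q % 4 ≡ 3 → ∀ a → ¬ Q ∣ 1 + a * a
  step Q rec Q%4≡3 a Q∣1+a² with even-root Q%4≡3 a Q∣1+a²
  -- The descent ends here: Q would divide 1, but 1 is not 3 modulo 4.
  ... | zero , _ , Q∣1 = contradiction (trans (sym Q%4≡3) (cong (_% 4) (∣1⇒≡1 Q∣1))) λ ()
  ... | c@(suc k) , 2c<Q , divides R 1+4c²≡RQ =
    rec R<Q (cofactor-3-mod-4 {R} Q%4≡3 RQ%4≡1) (2 * c) (subst (R ∣_) (sym 1+4c²≡RQ) (m∣m*n Q))
    where
    regroup : ∀ c → 1 + 2 * c * (2 * c) ≡ 1 + c * c * 4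
    regroup = solve-∀
    RQ%4≡1 : (R * Q) % 4 ≡ 1
    RQ%4≡1 = trans (cong (_% 4) (trans (sym 1+4c²≡RQ) (regroup c))) ([m+kn]%n≡m%n 1 (c * c) 4)

    -- RQ = 1 + 4c² < (2c + 1)² ≤ Q²; the gap between the first two is 4c = 4 + 4k, positive since c
    -- = `suc k`.
    square-gap : ∀ k → 2 + 2 * suc k * (2 * suc k) + (3 + 4 * k) ≡ suc (2 * suc k) * suc (2 * suc k)
    square-gap = solve-∀
    R<Q : R < Q
    R<Q = *-cancelʳ-< Q R Q (begin-strict
      R * Q                                 ≡⟨ 1+4c²≡RQ ⟨
      1 + 2 * c * (2 * c)                   <⟨ m≤m+n (2 + 2 * c * (2 * c)) (3 + 4 * k) ⟩
      2 + 2 * c * (2 * c) + (3 + 4 * k)     ≡⟨ square-gap k ⟩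
      suc (2 * c) * suc (2 * c)             ≤⟨ *-mono-≤ 2c<Q 2c<Q ⟩
      Q * Q                                 ∎)
      where open ≤-Reasoning

-- If p ∤ Q then p has an inverse x modulo Q, and xb would be a square root of -1.
prime∣modulus : ∀ {p Q b} → Prime p → Q % 4 ≡ 3 → Q ∣ p * p + b * b → p ∣ Q
prime∣modulus {p} {Q} {b} p-prime Q%4≡3 Q∣p²+b² with p ∣? Q
... | yes p∣Q = p∣Q
... | no  p∤Q = contradiction (root (coprime-Bézout p⊥Q)) λ (x , Q∣) → -1-nonresidue Q Q%4≡3 x Q∣
  where
  p⊥Q : Coprime p Q
  p⊥Q (d∣p , d∣Q) with prime⇒irreducible p-prime d∣p
  ... | inj₁ d≡1  = d≡1
  ... | inj₂ refl = contradiction d∣Q p∤Q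

  root : Bézout.Identity 1 p Q → ∃[ x ] Q ∣ 1 + x * x
  -- Here xp ≡ 1 (mod Q), so x²(p² + b²) ≡ 1 + (xb)².
  root (Bézout.+- x y 1+yQ≡xp) = x * b , ∣m+n∣m⇒∣n
    (subst (Q ∣_) expand (∣n⇒∣m*n (x * x) Q∣p²+b²)) (n∣m*n (2 * y + y * y * Q))
    where
    split : ∀ x p b → x * x * (p * p + b * b) ≡ x * p * (x * p) + x * b * (x * b)
    split = solve-∀
    square : ∀ y Q z → (1 + y * Q) * (1 + y * Q) + z ≡ (2 * y + y * y * Q) * Q + (1 + z)
    square = solve-∀
    expand : x * x * (p * p + b * b) ≡ (2 * y + y * y * Q) * Q + (1 + x * b * (x * b))
    expand = trans (split x p b)
      (trans (cong (λ u → u * u + x * b * (x * b)) (sym 1+yQ≡xp)) (square y Q _))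
  -- Here xp ≡ -1 (mod Q), whose square is again 1. Adding 2(1 + xp) = 2yQ turns (xp)² into (1 +
  -- xp)² + 1 and keeps the identity in ℕ.
  root (Bézout.-+ x y 1+xp≡yQ) = x * b , ∣m+n∣m⇒∣n
    (subst (Q ∣_) expand (∣m∣n⇒∣m+n (∣n⇒∣m*n (x * x) Q∣p²+b²) (n∣m*n (2 * y)))) (n∣m*n (y * y * Q))
    where
    split : ∀ x p b → x * x * (p * p + b * b) + 2 * (1 + x * p) ≡
                      (1 + x * p) * (1 + x * p) + (1 + x * b * (x * b))
    split = solve-∀
    assoc : ∀ y Q → y * Q * (y * Q) ≡ y * y * Q * Q
    assoc = solve-∀
    expand : x * x * (p * p + b * b) + 2 * y * Q ≡ y * y * Q * Q + (1 + x * b * (x * b))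
    expand = begin
      x * x * (p * p + b * b) + 2 * y * Q                   ≡⟨ cong (λ u → x * x * (p * p + b * b) + u) (*-assoc 2 y Q) ⟩
      x * x * (p * p + b * b) + 2 * (y * Q)                 ≡⟨ cong (λ u → x * x * (p * p + b * b) + 2 * u) 1+xp≡yQ ⟨
      x * x * (p * p + b * b) + 2 * (1 + x * p)             ≡⟨ split x p b ⟩
      (1 + x * p) * (1 + x * p) + (1 + x * b * (x * b))     ≡⟨ cong (λ u → u * u + (1 + x * b * (x * b))) 1+xp≡yQ ⟩
      y * Q * (y * Q) + (1 + x * b * (x * b))               ≡⟨ cong (_+ (1 + x * b * (x * b))) (assoc y Q) ⟩
      y * y * Q * Q + (1 + x * b * (x * b))                 ∎
      where open ≡-Reasoning

prime-divisor-of-sum-of-squares : ∀ {p q b} → Prime p → Prime q → q % 4 ≡ 3 → q ∣ p * p + b * b → p ≡ q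
prime-divisor-of-sum-of-squares {b = b} p-prime q-prime q%4≡3 q∣p²+b²
  with prime⇒irreducible q-prime (prime∣modulus {b = b} p-prime q%4≡3 q∣p²+b²)
... | inj₁ refl = contradiction p-prime ¬prime[1]
... | inj₂ p≡q  = p≡q

-- A composite n has a nontrivial divisor d with d² ≤ n, hence d < s. Primality thus becomes a
-- bounded search.
trial-division : ∀ {n} s .{{_ : NonTrivial n}} → n < s * s →
                 (∀ {d} → d < s → 1 < d → ¬ d ∣ n) → Prime n
trial-division s n<s² no-divisor = rough∧square>⇒prime {m = s} rough n<s²
  where
  rough : s Rough _
  rough (hasNonTrivialDivisor {d} d<s d∣n) = no-divisor d<s (nonTrivial⇒n>1 d) d∣n

-- Congruences in ℤ

infix 4 _≈_[mod_] _≈?_[mod_]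

-- As a record, the congruence determines its two sides during unification.
record _≈_[mod_] (x y : ℤ) (m : ℕ) : Set where
  constructor congruent
  field difference : + m ℤᵈ.∣ x ℤ.- y
open _≈_[mod_]

≡⇒mod : ∀ {m x y} → x ≡ y → x ≈ y [mod m ]
≡⇒mod {m} {x} refl = congruent (subst (+ m ℤᵈ.∣_) (sym (ℤₚ.+-inverseʳ x)) (ℤᵈ.∣ᵤ⇒∣ (m ∣0)))

mod-refl : ∀ {m x} → x ≈ x [mod m ]
mod-refl = ≡⇒mod refl

mod-sym : ∀ {m x y} → x ≈ y [mod m ] → y ≈ x [mod m ]
mod-sym {m} {x} {y} (congruent m∣x-y) =
  congruent (subst (+ m ℤᵈ.∣_) (negate x y) (ℤᵈ.∣m⇒∣-m m∣x-y))
  where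
  negate : ∀ x y → ℤ.- (x ℤ.- y) ≡ y ℤ.- x
  negate = ℤ-Solver.solve-∀

mod-trans : ∀ {m x y z} → x ≈ y [mod m ] → y ≈ z [mod m ] → x ≈ z [mod m ]
mod-trans {m} {x} {y} {z} (congruent m∣x-y) (congruent m∣y-z) =
  congruent (subst (+ m ℤᵈ.∣_) (telescope x y z) (ℤᵈ.∣m∣n⇒∣m+n m∣x-y m∣y-z))
  where
  telescope : ∀ x y z → (x ℤ.- y) ℤ.+ (y ℤ.- z) ≡ x ℤ.- z
  telescope = ℤ-Solver.solve-∀

mod-+ : ∀ {m x x′ y y′} → x ≈ x′ [mod m ] → y ≈ y′ [mod m ] → x ℤ.+ y ≈ x′ ℤ.+ y′ [mod m ]
mod-+ {m} {x} {x′} {y} {y′} (congruent m∣x-x′) (congruent m∣y-y′) =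
  congruent (subst (+ m ℤᵈ.∣_) (interchange x x′ y y′) (ℤᵈ.∣m∣n⇒∣m+n m∣x-x′ m∣y-y′))
  where
  interchange : ∀ x x′ y y′ → (x ℤ.- x′) ℤ.+ (y ℤ.- y′) ≡ (x ℤ.+ y) ℤ.- (x′ ℤ.+ y′)
  interchange = ℤ-Solver.solve-∀

mod-* : ∀ {m x x′ y y′} → x ≈ x′ [mod m ] → y ≈ y′ [mod m ] → x ℤ.* y ≈ x′ ℤ.* y′ [mod m ]
mod-* {m} {x} {x′} {y} {y′} (congruent m∣x-x′) (congruent m∣y-y′) =
  congruent (subst (+ m ℤᵈ.∣_) (leibniz x x′ y y′)
    (ℤᵈ.∣m∣n⇒∣m+n (ℤᵈ.∣n⇒∣m*n x m∣y-y′) (ℤᵈ.∣n⇒∣m*n y′ m∣x-x′)))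
  where
  leibniz : ∀ x x′ y y′ → x ℤ.* (y ℤ.- y′) ℤ.+ y′ ℤ.* (x ℤ.- x′) ≡ x ℤ.* y ℤ.- x′ ℤ.* y′
  leibniz = ℤ-Solver.solve-∀

mod-^ : ∀ {m x y} → x ≈ y [mod m ] → ∀ k → x ℤ.^ k ≈ y ℤ.^ k [mod m ]
mod-^ x≈y zero    = mod-refl
mod-^ x≈y (suc k) = mod-* x≈y (mod-^ x≈y k)

mod-divisor : ∀ {d m x y} → d ∣ m → x ≈ y [mod m ] → x ≈ y [mod d ]
mod-divisor d∣m (congruent m∣x-y) = congruent (ℤᵈ.∣-trans (ℤᵈ.∣ᵤ⇒∣ d∣m) m∣x-y)

mod-% : ∀ b r .{{_ : NonZero r}} → + b ≈ + (b % r) [mod r ]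
mod-% b r = congruent (ℤᵈ.divides (+ (b / r)) (begin
  + b ℤ.- + (b % r)                         ≡⟨ cong (λ u → + u ℤ.- + (b % r)) (m≡m%n+[m/n]*n b r) ⟩
  + (b % r) ℤ.+ + (b / r * r) ℤ.- + (b % r) ≡⟨ cancel (+ (b % r)) (+ (b / r * r)) ⟩
  + (b / r * r)                             ≡⟨ ℤₚ.pos-* (b / r) r ⟩
  + (b / r) ℤ.* + r                         ∎))
  where
  open ≡-Reasoning
  cancel : ∀ x y → x ℤ.+ y ℤ.- x ≡ y
  cancel = ℤ-Solver.solve-∀

^-periodic : ∀ {m g o} → g ℤ.^ o ≈ + 1 [mod m ] → ∀ a k → g ℤ.^ (a + o * k) ≈ g ℤ.^ a [mod m ]
^-periodic {m} {g} {o} g^o≡1 a k = mod-trans (≡⇒mod split)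
  (mod-trans (mod-* (mod-refl {x = g ℤ.^ a}) (mod-^ g^o≡1 k)) (≡⇒mod unit))
  where
  split : g ℤ.^ (a + o * k) ≡ g ℤ.^ a ℤ.* (g ℤ.^ o) ℤ.^ k
  split = trans (ℤₚ.^-distribˡ-+-* g a (o * k)) (cong (g ℤ.^ a ℤ.*_) (sym (ℤₚ.^-*-assoc g o k)))
  unit : g ℤ.^ a ℤ.* (+ 1) ℤ.^ k ≡ g ℤ.^ a
  unit = trans (cong (g ℤ.^ a ℤ.*_) (ℤₚ.^-zeroˡ k)) (ℤₚ.*-identityʳ _)

_≈?_[mod_] : ∀ x y m → Dec (x ≈ y [mod m ])
x ≈? y [mod m ] = map′ congruent difference (+ m ℤᵈ.∣? x ℤ.- y)

-- Certificates and what they exclude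

-- q, o, a and r are as above; modulo r, the powers of 2 with exponent ≡ a (mod o) take at most
-- t values, and s bounds the trial division that proves q prime.
record Certificate : Set where
  constructor cert
  field q o a r t s : ℕ

module _ (α : ℤ) (M L : ℕ) (c : Certificate) where
  open Certificate c

  -- For a < o this says n ≡ a (mod o). The bound a ≤ n is needed because truncated subtraction
  -- gives n ∸ a = 0 for all smaller n.
  Covers : ℕ → Set
  Covers n = a ≤ n × o ∣ n ∸ a

  covers? : ∀ n → Dec (Covers n)
  covers? n = (a ≤? n) ×-dec (o ∣? n ∸ a)

  ForcesPrime : Set
  ForcesPrime = q ∣ M × o ∣ L × (q % 4 ≡ 3) × 1 < q × q < s * s × (∀ {d} → d < s → 1 < d → ¬ d ∣ q) ×
                ((+ 2) ℤ.^ o ≈ + 1 [mod q ]) × (α ℤ.+ (+ 2) ℤ.^ a ≈ + 0 [mod q ])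

  forcesPrime? : Dec ForcesPrime
  forcesPrime? = (q ∣? M) ×-dec (o ∣? L) ×-dec (q % 4 ≟ 3) ×-dec (1 <? q) ×-dec (q <? s * s) ×-dec
    allUpTo? (λ d → (1 <? d) →-dec ¬? (d ∣? q)) s ×-dec
    ((+ 2) ℤ.^ o ≈? + 1 [mod q ]) ×-dec (α ℤ.+ (+ 2) ℤ.^ a ≈? + 0 [mod q ])

  -- A finite search suffices: for n = a + ok, 2ⁿ modulo `r` depends only on k modulo `t`, and b²
  -- only on b modulo `r`.
  RefutesPrime : Set
  RefutesPrime = r ∣ M × NonZero r × NonZero t × ((+ 2) ℤ.^ (o * t) ≈ + 1 [mod r ]) ×
    (∀ {j} → j < t → ∀ {b} → b < r →
      ¬ (+ q) ℤ.^ 2 ℤ.+ (+ b) ℤ.^ 2 ≈ α ℤ.+ (+ 2) ℤ.^ (a + o * j) [mod r ])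

  refutesPrime? : Dec RefutesPrime
  refutesPrime? = (r ∣? M) ×-dec nonZero? r ×-dec nonZero? t ×-dec ((+ 2) ℤ.^ (o * t) ≈? + 1 [mod r ]) ×-dec
    allUpTo? (λ j → allUpTo? (λ b →
      ¬? ((+ q) ℤ.^ 2 ℤ.+ (+ b) ℤ.^ 2 ≈? α ℤ.+ (+ 2) ℤ.^ (a + o * j) [mod r ])) r) t

  -- Since o ∣ L, the covering of ℕ has to be checked on one period i < L only.
  covers-periodic : ForcesPrime → ∀ i l → Covers i → Covers (i + l * L)
  covers-periodic (_ , o∣L , _) i l (a≤i , o∣i∸a) =
    ≤-trans a≤i (m≤m+n i (l * L)) ,
    subst (o ∣_) (sym (+-∸-comm (l * L) a≤i)) (∣m∣n⇒∣m+n o∣i∸a (∣n⇒∣m*n l o∣L))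

  exponent : ∀ {n} → Covers n → ∃[ k ] n ≡ a + o * k
  exponent {n} (a≤n , divides k n∸a≡ko) =
    k , trans (sym (m+[n∸m]≡n a≤n)) (cong (λ u → a + u) (trans n∸a≡ko (*-comm k o)))

  -- On the covered class 2ⁿ ≡ 2ᵃ (mod q), so p² + b² ≡ α + 2ᵃ ≡ 0 (mod q).
  covered-prime : ForcesPrime → ∀ {n p b} → Covers n → Prime p →
    (+ p) ℤ.^ 2 ℤ.+ (+ b) ℤ.^ 2 ≈ α ℤ.+ (+ 2) ℤ.^ n [mod M ] → p ≡ q
  covered-prime (q∣M , _ , q%4≡3 , 1<q , q<s² , no-divisor , 2^o≡1 , q∣α+2^a) {n} {p} {b} covers p-prime eq
    with exponent covers
  ... | k , refl = prime-divisor-of-sum-of-squares {b = b} p-prime q-prime q%4≡3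
      (ℤᵈ.∣⇒∣ᵤ (subst (+ q ℤᵈ.∣_) natural (difference sum≈0)))
    where
    q-prime : Prime q
    q-prime = trial-division s {{n>1⇒nonTrivial 1<q}} q<s² no-divisor

    sum≈0 : (+ p) ℤ.^ 2 ℤ.+ (+ b) ℤ.^ 2 ≈ + 0 [mod q ]
    sum≈0 = mod-trans (mod-divisor q∣M eq)
      (mod-trans (mod-+ (mod-refl {x = α}) (^-periodic {o = o} 2^o≡1 a k)) q∣α+2^a)

    -- x * (x * 1) is the form to which `x ^ 2` reduces.
    unfold : ∀ x y → x ℤ.* (x ℤ.* + 1) ℤ.+ y ℤ.* (y ℤ.* + 1) ℤ.- + 0 ≡ x ℤ.* x ℤ.+ y ℤ.* y
    unfold = ℤ-Solver.solve-∀
    natural : (+ p) ℤ.^ 2 ℤ.+ (+ b) ℤ.^ 2 ℤ.- + 0 ≡ + (p * p + b * b)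
    natural = trans (unfold (+ p) (+ b)) (cong₂ ℤ._+_ (sym (ℤₚ.pos-* p p)) (sym (ℤₚ.pos-* b b)))

  -- Once p = q, reducing k modulo `t` and b modulo `r` produces a pair that the finite search has
  -- ruled out.
  covered-contradiction : ForcesPrime → RefutesPrime → ∀ {n p b} → Covers n → Prime p →
    ¬ (+ p) ℤ.^ 2 ℤ.+ (+ b) ℤ.^ 2 ≈ α ℤ.+ (+ 2) ℤ.^ n [mod M ]
  covered-contradiction forces (r∣M , r≢0 , t≢0 , 2^ot≡1 , nonsquare) {n} {p} {b} covers p-prime eq
    with covered-prime forces {b = b} covers p-prime eq | exponent covers
  ... | refl | k , refl = nonsquare (m%n<n k t) (m%n<n b r)
      (mod-trans (mod-+ (mod-refl {x = (+ q) ℤ.^ 2}) (mod-^ (mod-sym (mod-% b r)) 2))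
        (mod-trans (mod-divisor r∣M eq)
          (mod-+ (mod-refl {x = α}) (mod-trans (≡⇒mod (cong ((+ 2) ℤ.^_) reduce))
            (^-periodic {o = o * t} 2^ot≡1 (a + o * (k % t)) (k / t))))))
    where
    instance
      _ = r≢0
      _ = t≢0
    regroup : ∀ a o j t l → a + o * (j + l * t) ≡ a + o * j + o * t * l
    regroup = solve-∀
    reduce : a + o * k ≡ a + o * (k % t) + o * t * (k / t)
    reduce = trans (cong (λ u → a + o * u) (m≡m%n+[m/n]*n k t)) (regroup a o (k % t) t (k / t))

-- The residue of n modulo L selects a certificate, and periodicity carries it over to n. With x ≡ α
-- (mod M), the equation x = p² + b² - 2ⁿ becomes p² + b² ≡ α + 2ⁿ (mod M).
covering⇒unrepresentable : ∀ α M L .{{_ : NonZero L}} {cs} →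
  All (ForcesPrime α M L) cs → All (RefutesPrime α M L) cs →
  (∀ {i} → i < L → Any (λ c → Covers α M L c i) cs) →
  ∀ {x} → x ≡ α [mod M ] → ¬ Representable x
covering⇒unrepresentable α M L forcing refuting covering x≡α (p , b , n , p-prime , x≡)
  with find (covering (m%n<n n L))
... | c , c∈ , covers =
  covered-contradiction α M L c forces (All.lookup refuting c∈) {n} {p} {b}
    (subst (Covers α M L c) (sym (m≡m%n+[m/n]*n n L))
      (covers-periodic α M L c forces (n % L) (n / L) covers))
    p-prime
    (congruent (subst (+ M ℤᵈ.∣_) (trans (cong (ℤ._- α) x≡) (regroup ((+ p) ℤ.^ 2 ℤ.+ (+ b) ℤ.^ 2) ((+ 2) ℤ.^ n) α)) x≡α))
  where
  forces : ForcesPrime α M L c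
  forces = All.lookup forcing c∈
  regroup : ∀ s u α → s ℤ.- u ℤ.- α ≡ s ℤ.- (α ℤ.+ u)
  regroup = ℤ-Solver.solve-∀

-- The covering system and its verification

certificates : List Certificate
certificates =
  -- This class is the odd n; all later classes consist of even n. With α ≡ 4 (mod 5), α + 2ⁿ - 9 is
  -- 2 or 3 modulo 5, never a square.
  cert 3 2 1 5 2 2 ∷
  -- `o` is a multiple of the order of 2 modulo `q`, not always the order itself, which is 3 for q =
  -- 7.
  cert 7 6 0 331 5 3 ∷
  cert 31 10 2 11 1 6 ∷
  cert 11 10 4 31 1 4 ∷
  cert 127 14 2 43 1 12 ∷
  cert 43 14 10 29 2 7 ∷
  cert 19 18 16 13 2 5 ∷
  cert 151 30 26 11 1 13 ∷
  cert 331 30 20 7 1 19 ∷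
  cert 5419 42 4 19 3 74 ∷
  cert 251 50 38 31 1 16 ∷
  cert 4051 50 28 251 1 64 ∷
  cert 87211 54 28 13 2 296 ∷
  cert 71 70 8 11 1 9 ∷
  cert 86171 70 48 43 1 294 ∷
  cert 631 90 40 11 1 26 ∷
  cert 23311 90 76 151 1 153 ∷
  cert 29191 210 158 71 1 171 ∷
  cert 211 210 98 31 1 15 ∷
  cert 271 270 100 11 1 17 ∷
  cert 348031 270 226 31 1 590 ∷
  cert 811 270 46 11 1 29 ∷
  cert 39551 350 348 11 1 199 ∷
  cert 1051 350 208 11 1 33 ∷
  cert 110251 350 68 31 1 333 ∷
  cert 1560007 378 280 13 2 1250 ∷
  cert 379 378 334 29 2 20 ∷
  cert 119827 378 118 19 1 347 ∷
  cert 870031 630 238 13 2 933 ∷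
  cert 983431 630 190 13 2 992 ∷
  cert 1765891 630 28 11 1 1329 ∷ []

-- The least common multiple 2 · 3³ · 5² · 7 of all `o`.
period : ℕ
period = 9450

modulus : ℕ
modulus = 5 * 13 * 29 * product (map Certificate.q certificates)

-- The solution of α ≡ -2ᵃ (mod q) for all certificates, α ≡ 4 (mod 5), 5 (mod 13) and 28 (mod 29).
residue : ℤ
residue = + 15401445836026952273594798056127862034928019935758731427726978293673329595968577951639605645334595532236914

forcing : All (ForcesPrime residue modulus period) certificates
forcing = toWitness {a? = All.all? (forcesPrime? residue modulus period) certificates} _

refuting : All (RefutesPrime residue modulus period) certificates
refuting = toWitness {a? = All.all? (refutesPrime? residue modulus period) certificates} _

covering : ∀ {i} → i < period → Any (λ c → Covers residue modulus period c i) certificates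
covering = toWitness
  {a? = allUpTo? (λ i → Any.any? (λ c → covers? residue modulus period c i) certificates) period} _

theorem3 : Σ[ M ∈ ℕ ] Σ[ α ∈ ℤ ] (0 < M × Odd M × ((x : ℤ) → x ≡ α [mod M ] → ¬ Representable x))
-- Division by 2 rounds down, so 2 * (`modulus` / 2) + 1 evaluates to the odd number `modulus`.
theorem3 = modulus , residue , toWitness {a? = 0 <? modulus} _ , (modulus / 2 , refl) ,
  λ _ → covering⇒unrepresentable residue modulus period forcing refuting covering
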